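{- Let $N\ge9$, $\alpha\in\{2,3,4\}$ with $\alpha\mid N$, and $M_\alpha=N/\alpha$. Let $g$ be a $2\times5$ matrix over $\mathbb{Z}_N$ generating an admissible linear code, with columns indexed by $i=0,\dots,4$ and $\gcd_i=\gcd(g_{1i},g_{2i},N)$. Suppose exactly two columns of $g$ have $\gcd_i=M_\alpha$ and the other columns have $\gcd_i<M_\alpha$. Then $g$ cannot generate a thin non-degenerate linear code.
   Context: $\mathbb{Z}_N=\mathbb{Z}/N\mathbb{Z}$; its elements are identified with the representatives $0,1,\dots,N-1$, and gcd's are taken of these integers. The code generated by $g$ is the submodule of $\mathbb{Z}_N^5$ generated by the rows of $g$. A linear code is extended if every word has coordinate sum $0\bmod N$; call it admissible if it is extended and the greatest common divisor of $N$ and all entries of all words (equivalently of $N$ and all entries of $g$) is $1$. It is degenerate if some coordinate is zero in all words. An extended code is thin if it contains no word all of whose entries are nonzero. -}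

module Defs where

open import Data.Fin.Base using (Fin; toℕ)
open import Data.Nat.Base as ℕ using (ℕ; NonZero)
open import Data.Nat.Divisibility using (_∣_)
open import Data.Nat.DivMod using (_mod_)
open import Data.Nat.GCD using (gcd)
open import Data.Product.Base using (_×_; ∃; ∃₂)
open import Data.Sum.Base using (_⊎_)
open import Data.Vec.Functional using (Vector; foldr)
open import Level using (0ℓ)
open import Relation.Binary.PropositionalEquality.Core using (_≡_; _≢_)
open import Relation.Nullary.Negation.Core using (¬_)
open import Relation.Unary using (Pred)

-- Residue classes modulo N are identified with their representatives
-- 0, …, N ∸ 1, so propositional equality on Fin N is equality in ℤ/Nℤ.
ℤ/_ : ℕ → Set
ℤ/ N = Fin N

module _ {N : ℕ} .{{_ : NonZero N}} where

  infixl 6 _+_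
  infixl 7 _*_

  0# : ℤ/ N
  0# = 0 mod N

  _+_ : ℤ/ N → ℤ/ N → ℤ/ N
  x + y = (toℕ x ℕ.+ toℕ y) mod N

  _*_ : ℤ/ N → ℤ/ N → ℤ/ N
  x * y = (toℕ x ℕ.* toℕ y) mod N

  ∑ : ∀ {n} → Vector (ℤ/ N) n → ℤ/ N
  ∑ = foldr _+_ 0#

Word : ℕ → ℕ → Set
Word N n = Vector (ℤ/ N) n

Matrix : ℕ → ℕ → ℕ → Set
Matrix N m n = Vector (Word N n) m

Code : ℕ → ℕ → Set₁
Code N n = Pred (Word N n) 0ℓ

IsGCD : Pred ℕ 0ℓ → ℕ → Set
IsGCD S d = (∀ k → S k → d ∣ k) × (∀ e → (∀ k → S k → e ∣ k) → e ∣ d)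

module _ {N : ℕ} .{{_ : NonZero N}} where

  -- The ℤ/N-linear combinations of the rows of g.  Words are functions, hence
  -- compared pointwise.
  ⟨_⟩ : ∀ {m n} → Matrix N m n → Code N n
  ⟨_⟩ {m} g w = ∃ λ (c : Vector (ℤ/ N) m) → ∀ i → w i ≡ ∑ (λ r → c r * g r i)

  Extended : ∀ {n} → Code N n → Set
  Extended C = ∀ w → C w → ∑ w ≡ 0#

  ModulusOrEntry : ∀ {n} → Code N n → Pred ℕ 0ℓ
  ModulusOrEntry C k = k ≡ N ⊎ ∃₂ λ w i → C w × k ≡ toℕ (w i)

  Admissible : ∀ {n} → Code N n → Set
  Admissible C = Extended C × IsGCD (ModulusOrEntry C) 1

  Degenerate : ∀ {n} → Code N n → Set
  Degenerate C = ∃ λ i → ∀ w → C w → w i ≡ 0#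

  Thin : ∀ {n} → Code N n → Set
  Thin C = ¬ (∃ λ w → C w × (∀ i → w i ≢ 0#))

columnGcd : ∀ {N m n} → Matrix N m n → Fin n → ℕ
columnGcd {N} g i = foldr gcd N (λ r → toℕ (g r i))

ExactlyTwo : ∀ {A : Set} → Pred A 0ℓ → Set
ExactlyTwo P = ∃₂ λ i j → i ≢ j × P i × P j × (∀ k → P k → k ≡ i ⊎ k ≡ j)

{-# OPTIONS --safe #-}
module Submission where

open import Defs hiding (_+_; _*_)
import Defs as ℤ/N
open import Data.Empty using (⊥)
open import Data.Fin.Base using (Fin; zero; suc; toℕ; punchIn; punchOut)
open import Data.Fin.Properties using (toℕ-fromℕ<; punchIn-punchOut; punchInᵢ≢i; punchIn-injective; ¬∀⟶∃¬; _≟_)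
open import Data.Integer.Base using (ℤ; +_; _+_; _-_; -_; _*_; 0ℤ; 1ℤ)
open import Data.Integer.DivMod using (_%ℕ_; _/ℕ_; n%ℕd<d; a≡a%ℕn+[a/ℕn]*n)
open import Data.Integer.Divisibility.Signed renaming (_∣_ to _∣ℤ_)
import Data.Integer.Properties as ℤ
open import Algebra.Properties.CommutativeMonoid.Sum ℤ.+-0-commutativeMonoid using (sum-remove)
open import Data.Integer.Tactic.RingSolver using (solve-∀)
open import Data.Nat.Base as ℕ using (ℕ; NonZero; _≤_; _<_; _/_; s≤s; z≤n; z<s)
open import Data.Nat.Coprimality using (coprime-divisor; coprime-/gcd)
open import Data.Nat.DivMod using (_mod_; _%_; m≡m%n+[m/n]*n; m%n<n; m/n*n≡m; m*[n/m]≡n)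
open import Data.Nat.Divisibility using (_∣_)
import Data.Nat.Divisibility as ℕ∣
open import Data.Nat.GCD using (gcd; gcd[m,n]∣m; gcd[m,n]∣n; gcd-greatest; c*gcd[m,n]≡gcd[cm,cn]; gcd[m,n]≢0)
import Data.Nat.Properties as ℕ
open import Data.Product.Base using (_×_; _,_; ∃; ∃₂; proj₁; proj₂)
open import Data.Sum.Base using (_⊎_; inj₁; inj₂; [_,_]′; map₂; swap; assocʳ)
open import Data.Vec.Functional using (Vector; foldr)
open import Function.Base using (_∘_)
open import Level using (0ℓ)
open import Relation.Binary.PropositionalEquality using (_≡_; _≢_; refl; sym; trans; cong; cong₂; subst; subst₂)
open import Relation.Nullary using (¬_; yes; no; contradiction)
open import Relation.Nullary.Decidable using (decidable-stable)
open import Relation.Unary using (Pred)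

-- Call the two columns of order α a and b, the others c, d, e, and let K be the
-- subcode where a and b vanish.  Multiplication by α maps the code into K, so none
-- of c, d, e vanishes on K, and c + d + e = 0 there.  If the code is thin, every
-- coset x + K with x a, x b ≠ 0 is covered by the zero sets of c, d and e, which are
-- cosets of kernels with equal pairwise intersections.  Such a cover needs all three
-- sets, and either 4 annihilates c, d, e on K and 2 annihilates one of them, or 3
-- annihilates all of them.  For α = 2 this makes N a divisor of 8 or 6.  For α ≥ 3, an
-- m ∈ {2, 3} annihilating one of c, d, e on K annihilates it at every x with
-- x a, x b ≠ 0; these x generate the code, so that column has order at most m ≤ α.

-- Arithmetic of integer lifts, where an entry counts as zero when `n` divides it.

_⊕_ _⊖_ : {I : Set} → (I → ℤ) → (I → ℤ) → I → ℤ
(v ⊕ w) i = v i + w i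
(v ⊖ w) i = v i - w i

infixl 6 _⊕_ _⊖_

even⊎odd : ∀ q → ∃ λ t → q ≡ t * + 2 ⊎ q ≡ + 1 + t * + 2
even⊎odd q with q %ℕ 2 | q /ℕ 2 | n%ℕd<d q 2 | a≡a%ℕn+[a/ℕn]*n q 2
... | 0 | t | _ | eq = t , inj₁ (trans eq (ℤ.+-identityˡ _))
... | 1 | t | _ | eq = t , inj₂ eq
... | ℕ.suc (ℕ.suc _) | t | s≤s (s≤s ()) | eq

module _ {n : ℤ} where

  ∣-scale : ∀ m {u v} → m * u ≡ v → n ∣ℤ u → n ∣ℤ v
  ∣-scale m refl = ∣n⇒∣m*n m

  ∣-rearrange : ∀ {u v} → u ≡ v → n ∣ℤ u → n ∣ℤ v
  ∣-rearrange = subst (n ∣ℤ_)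

  ∣-double : ∀ u → n ∣ℤ u + u → n ∣ℤ + 2 * u
  ∣-double u = ∣-rearrange (lem u) where
    lem : ∀ u → u + u ≡ + 2 * u
    lem = solve-∀

  ∤-double : ∀ u → ¬ n ∣ℤ u + u → ¬ n ∣ℤ u
  ∤-double _ ¬p p = ¬p (∣m∣n⇒∣m+n p p)

  ∣-double⁻ : ∀ u v → n ∣ℤ u + v → n ∣ℤ v + v → n ∣ℤ u + u
  ∣-double⁻ u v p q = ∣-rearrange (lem u v) (∣m∣n⇒∣m-n (∣m∣n⇒∣m+n p p) q)
    where
    lem : ∀ u v → (u + v) + (u + v) - (v + v) ≡ u + u
    lem = solve-∀

  halve : ∀ u s → u + u ≡ s * + 2 * n → u ≡ s * n
  halve u s 2u≡2sn = ℤ.*-cancelʳ-≡ u (s * n) (+ 2) (trans (lem u) (trans 2u≡2sn (lem′ s n)))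
    where
    lem : ∀ u → u * + 2 ≡ u + u
    lem = solve-∀
    lem′ : ∀ s n → s * + 2 * n ≡ s * n * + 2
    lem′ = solve-∀

  -- u + u ≡ q n with q even would force n ∣ℤ u, so both quotients are odd.
  involutions-cancel : ∀ {u v} → n ∣ℤ u + u → n ∣ℤ v + v → ¬ n ∣ℤ u → ¬ n ∣ℤ v → n ∣ℤ u + v
  involutions-cancel {u} {v} (divides p 2u≡pn) (divides q 2v≡qn) n∤u n∤v
    with even⊎odd p | even⊎odd q
  ... | s , inj₁ refl | _ = contradiction (divides s (halve u s 2u≡pn)) n∤u
  ... | _ | t , inj₁ refl = contradiction (divides t (halve v t 2v≡qn)) n∤v
  ... | s , inj₂ refl | t , inj₂ refl = divides (s + t + + 1)
        (ℤ.*-cancelʳ-≡ (u + v) ((s + t + + 1) * n) (+ 2)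
          (trans (lem u v) (trans (cong₂ _+_ 2u≡pn 2v≡qn) (lem′ s t n))))
    where
    lem : ∀ u v → (u + v) * + 2 ≡ (u + u) + (v + v)
    lem = solve-∀
    lem′ : ∀ s t n → (+ 1 + s * + 2) * n + (+ 1 + t * + 2) * n ≡ (s + t + + 1) * n * + 2
    lem′ = solve-∀

-- Covering a coset by the zero sets of three coordinates.

module ThreeCosets (n : ℤ) {I : Set} (K X : Pred (I → ℤ) 0ℓ) where

  Killed : ℕ → I → Set
  Killed m i = ∀ k → K k → n ∣ℤ + m * k i

  record Covering (c d e : I) : Set where
    field
      K-⊕   : ∀ {k l} → K k → K l → K (k ⊕ l)
      X-⊕   : ∀ {x k} → X x → K k → X (x ⊕ k)
      sum-0 : ∀ {k} → K k → n ∣ℤ k c + k d + k e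
      c≢0   : ∃ λ k → K k × ¬ n ∣ℤ k c
      d≢0   : ∃ λ k → K k × ¬ n ∣ℤ k d
      e≢0   : ∃ λ k → K k × ¬ n ∣ℤ k e
      cover : ∀ {x} → X x → n ∣ℤ x c ⊎ n ∣ℤ x d ⊎ n ∣ℤ x e
      point : ∃ X

  rotate : ∀ {c d e} → Covering c d e → Covering d e c
  rotate {c} {d} {e} C = record
    { K-⊕ = K-⊕ ; X-⊕ = X-⊕ ; point = point
    ; sum-0 = λ {k} Kk → ∣-rearrange (lem (k c) (k d) (k e)) (sum-0 Kk)
    ; c≢0 = d≢0 ; d≢0 = e≢0 ; e≢0 = c≢0
    ; cover = λ Xx → assocʳ (swap (cover Xx)) }
    where
    open Covering C
    lem : ∀ x y z → x + y + z ≡ y + z + x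
    lem = solve-∀

  mirror : ∀ {c d e} → Covering c d e → Covering c e d
  mirror {c} {d} {e} C = record
    { K-⊕ = K-⊕ ; X-⊕ = X-⊕ ; point = point
    ; sum-0 = λ {k} Kk → ∣-rearrange (lem (k c) (k d) (k e)) (sum-0 Kk)
    ; c≢0 = c≢0 ; d≢0 = e≢0 ; e≢0 = d≢0
    ; cover = λ Xx → map₂ swap (cover Xx) }
    where
    open Covering C
    lem : ∀ x y z → x + y + z ≡ x + z + y
    lem = solve-∀

  module _ {c d e : I} (C : Covering c d e) where
    open Covering C

    de⇒c : ∀ {k} → K k → n ∣ℤ k d + k e → n ∣ℤ k c
    de⇒c {k} Kk p = ∣m+n∣n⇒∣m (∣-rearrange (ℤ.+-assoc (k c) (k d) (k e)) (sum-0 Kk)) p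

    c⇒de : ∀ {k} → K k → n ∣ℤ k c → n ∣ℤ k d + k e
    c⇒de {k} Kk p = ∣m+n∣m⇒∣n (∣-rearrange (ℤ.+-assoc (k c) (k d) (k e)) (sum-0 Kk)) p

    -- Two of the three cosets never suffice.
    vanishes-somewhere : ¬ (∀ x → X x → ¬ n ∣ℤ x c)
    vanishes-somewhere never = find (d-or-e Xx₀)
      where
      x₀ = proj₁ point
      Xx₀ = proj₂ point
      d-or-e : ∀ {x} → X x → n ∣ℤ x d ⊎ n ∣ℤ x e
      d-or-e {x} Xx with cover Xx
      ... | inj₁ p = contradiction p (never x Xx)
      ... | inj₂ p = p

      kc = proj₁ c≢0
      Kkc = proj₁ (proj₂ c≢0)

      module _ (y : I → ℤ) (Xy : X y) (yd : n ∣ℤ y d) where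

        off-d : ∀ {k} → K k → ¬ n ∣ℤ k d → n ∣ℤ y e + k e
        off-d Kk kd with d-or-e (X-⊕ Xy Kk)
        ... | inj₁ p = contradiction (∣m+n∣m⇒∣n p yd) kd
        ... | inj₂ p = p

        d⇒e : ∀ {k} → K k → n ∣ℤ k d → n ∣ℤ k e
        d⇒e {k} Kk kd with d≢0
        -- Both `l` and `l ⊕ k` leave the zero set of `d`, so `y e + l e` and `y e + l e + k e` both
        -- vanish.
        ... | l , Kl , ld = ∣m+n∣m⇒∣n
          (∣-rearrange (sym (ℤ.+-assoc (y e) (l e) (k e)))
            (off-d (K-⊕ Kl Kk) (λ p → ld (∣m+n∣n⇒∣m p kd))))
          (off-d Kl ld)

        kcd : ¬ n ∣ℤ kc d
        kcd p = proj₂ (proj₂ c≢0) (de⇒c Kkc (∣m∣n⇒∣m+n p (d⇒e Kkc p)))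

        ye : ¬ n ∣ℤ y e
        ye p with e≢0
        ... | k , Kk , ke with n ∣? k d
        ... | yes kd = ke (d⇒e Kk kd)
        ... | no  kd = ke (∣m+n∣m⇒∣n (off-d Kk kd) p)

        kce : ¬ n ∣ℤ kc e
        kce p = ye (∣m+n∣n⇒∣m (off-d Kkc kcd) p)

        2kcd : n ∣ℤ kc d + kc d
        2kcd = decidable-stable (n ∣? (kc d + kc d)) λ ¬p → kce (∣m+n∣m⇒∣n
          (∣-rearrange (sym (ℤ.+-assoc (y e) (kc e) (kc e))) (off-d (K-⊕ Kkc Kkc) ¬p))
          (off-d Kkc kcd))

        impossible : ⊥
        -- Both `kc d` and `kc e` are nonzero involutions, so they cancel, and the zero sum forces
        -- `kc c` to vanish.
        impossible = proj₂ (proj₂ c≢0)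
          (de⇒c Kkc (involutions-cancel 2kcd (d⇒e (K-⊕ Kkc Kkc) 2kcd) kcd kce))

      find : n ∣ℤ x₀ d ⊎ n ∣ℤ x₀ e → ⊥
      find (inj₁ p) = impossible x₀ Xx₀ p
      find (inj₂ p) with e≢0
      -- From a zero of `e`, a translation with `k e` nonzero leaves the zero set of `e` and so
      -- reaches that of `d`.
      ... | k , Kk , ke with d-or-e (X-⊕ Xx₀ Kk)
      ... | inj₁ q = impossible (x₀ ⊕ k) (X-⊕ Xx₀ Kk) q
      ... | inj₂ q = ke (∣m+n∣m⇒∣n q p)

    -- Divisibility is decidable, so a zero of `c` known to exist only up to double negation is
    -- enough for such a goal.
    at-a-zero-of-c : ∀ {u} → (∀ {x} → X x → n ∣ℤ x c → n ∣ℤ u) → n ∣ℤ u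
    at-a-zero-of-c {u} f = decidable-stable (n ∣? u) λ n∤u →
      vanishes-somewhere λ x Xx xc → n∤u (f Xx xc)

  -- Off the zero set of c the translates by k must be covered alternately by d and e.
  alternate : ∀ {c d e k y} → Covering c d e → K k → n ∣ℤ k c → ¬ n ∣ℤ k d →
              X y → ¬ n ∣ℤ y c → n ∣ℤ y d → n ∣ℤ y e + k e × n ∣ℤ k d + k d
  alternate {c} {d} {e} {k} {y} C Kk kc kd Xy yc yd = ye+ke , 2kd
    where
    open Covering C
    ke : ¬ n ∣ℤ k e
    ke p = kd (∣m+n∣n⇒∣m (c⇒de C Kk kc) p)

    ye+ke : n ∣ℤ y e + k e
    ye+ke with cover (X-⊕ Xy Kk)
    ... | inj₁ p = contradiction (∣m+n∣n⇒∣m p kc) yc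
    ... | inj₂ (inj₁ p) = contradiction (∣m+n∣m⇒∣n p yd) kd
    ... | inj₂ (inj₂ p) = p

    2kd : n ∣ℤ k d + k d
    2kd with cover (X-⊕ (X-⊕ Xy Kk) Kk)
    ... | inj₁ p = contradiction (∣m+n∣n⇒∣m (∣m+n∣n⇒∣m p kc) kc) yc
    ... | inj₂ (inj₁ p) = ∣m+n∣m⇒∣n (∣-rearrange (ℤ.+-assoc (y d) (k d) (k d)) p) yd
    ... | inj₂ (inj₂ p) = contradiction (∣m+n∣m⇒∣n p ye+ke) ke

  module _ {c d e : I} (C : Covering c d e) {k : I → ℤ} (Kk : K k) (kc : n ∣ℤ k c) (kd : ¬ n ∣ℤ k d) where
    open Covering C

    private
      kd+ke : n ∣ℤ k d + k e
      kd+ke = c⇒de C Kk kc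

      ke : ¬ n ∣ℤ k e
      ke p = kd (∣m+n∣n⇒∣m kd+ke p)

      ke+kd : n ∣ℤ k e + k d
      ke+kd = ∣-rearrange (ℤ.+-comm (k d) (k e)) kd+ke

      lem-d : ∀ yd ye kd ke → yd + (ye + ke) - (kd + ke) + (kd + kd) ≡ (yd + ye) + kd
      lem-d = solve-∀

      lem-e : ∀ yd ye kd → ye + (yd + kd) ≡ (yd + ye) + kd
      lem-e = solve-∀

    -- Translation by `k` alternates between the zero sets of `d` and `e`. So one of `y d`, `y e`
    -- vanishes and the other is congruent to `k d`, which has order 2; the class of `y d + y e` is
    -- then the same at every point off the zero set of `c`.
    off-c : ∀ {y} → X y → ¬ n ∣ℤ y c → n ∣ℤ y d + y d × n ∣ℤ y e + y e × n ∣ℤ (y d + y e) + k d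
    off-c {y} Xy yc with cover Xy
    ... | inj₁ p = contradiction p yc
    ... | inj₂ (inj₁ yd) with alternate C Kk kc kd Xy yc yd
    ... | ye+ke , 2kd = ∣m∣n⇒∣m+n yd yd , ∣-double⁻ (y e) (k e) ye+ke (∣-double⁻ (k e) (k d) ke+kd 2kd) ,
          ∣-rearrange (lem-d (y d) (y e) (k d) (k e))
            (∣m∣n⇒∣m+n (∣m∣n⇒∣m-n (∣m∣n⇒∣m+n yd ye+ke) kd+ke) 2kd)
    off-c {y} Xy yc | inj₂ (inj₂ ye) with alternate (mirror C) Kk kc ke Xy yc ye
    ... | yd+kd , 2ke = ∣-double⁻ (y d) (k d) yd+kd (∣-double⁻ (k d) (k e) kd+ke 2ke) , ∣m∣n⇒∣m+n ye ye ,
          ∣-rearrange (lem-e (y d) (y e) (k d)) (∣m∣n⇒∣m+n ye yd+kd)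

    -- By `off-c`, two points off the zero set of `c` that differ by `l` have equal `d + e`, so
    -- `l d + l e`, and with it `l c`, vanishes. Hence if `x c` is zero and `l c` is not, `x + l` is
    -- off that set and `x + 2l` must return to it.
    killed-2 : Killed 2 c
    killed-2 l Kl = ∣-double (l c) (at-a-zero-of-c C from)
      where
      lem : ∀ yd ye kd ld le → (yd + ld) + (ye + le) + kd - ((yd + ye) + kd) ≡ ld + le
      lem = solve-∀

      both-off : ∀ {y} → X y → ¬ n ∣ℤ y c → ¬ n ∣ℤ y c + l c → n ∣ℤ l c
      both-off {y} Xy yc ylc = de⇒c C Kl (∣-rearrange (lem (y d) (y e) (k d) (l d) (l e))
        (∣m∣n⇒∣m-n (proj₂ (proj₂ (off-c (X-⊕ Xy Kl) ylc))) (proj₂ (proj₂ (off-c Xy yc)))))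

      from : ∀ {x} → X x → n ∣ℤ x c → n ∣ℤ l c + l c
      from {x} Xx xc with n ∣? l c | n ∣? (x c + l c + l c)
      ... | yes lc | _ = ∣m∣n⇒∣m+n lc lc
      ... | no _   | yes p = ∣m+n∣m⇒∣n (∣-rearrange (ℤ.+-assoc (x c) (l c) (l c)) p) xc
      ... | no lc  | no q = contradiction
            (both-off (X-⊕ Xx Kl) (λ p → lc (∣m+n∣m⇒∣n p xc)) q) lc

    off-point : ∃ λ y → X y × ¬ n ∣ℤ y c
    off-point with n ∣? proj₁ point c | c≢0
    ... | no q  | _ = _ , proj₂ point , q
    ... | yes p | l , Kl , lc = _ , X-⊕ (proj₂ point) Kl , λ q → lc (∣m+n∣m⇒∣n q p)

    -- Doubling `l` makes its `c` entry vanish, so adding `2l` keeps a point off the zero set of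
    -- `c`. Twice the `d` and `e` entries vanish at both points; subtracting gives `4 (l d)` and
    -- `4 (l e)`.
    killed-4 : Killed 4 c × Killed 4 d × Killed 4 e
    killed-4 = (λ l Kl → ∣-scale (+ 2) (lem₁ (l c)) (killed-2 l Kl)) ,
               (λ l Kl → ∣-rearrange (lem₂ (l d)) (proj₁ (2lde (K-⊕ Kl Kl) (2lc l Kl)))) ,
               (λ l Kl → ∣-rearrange (lem₂ (l e)) (proj₂ (2lde (K-⊕ Kl Kl) (2lc l Kl))))
      where
      lem₁ : ∀ u → + 2 * (+ 2 * u) ≡ + 4 * u
      lem₁ = solve-∀
      lem₂ : ∀ u → (u + u) + (u + u) ≡ + 4 * u
      lem₂ = solve-∀
      lem₃ : ∀ y l → (y + l) + (y + l) - (y + y) ≡ l + l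
      lem₃ = solve-∀
      lem₄ : ∀ u → + 2 * u ≡ u + u
      lem₄ = solve-∀

      2lc : ∀ l → K l → n ∣ℤ l c + l c
      2lc l Kl = ∣-rearrange (lem₄ (l c)) (killed-2 l Kl)

      2lde : ∀ {l} → K l → n ∣ℤ l c → n ∣ℤ l d + l d × n ∣ℤ l e + l e
      2lde {l} Kl lc with off-point
      ... | y , Xy , yc with off-c Xy yc | off-c (X-⊕ Xy Kl) (λ p → yc (∣m+n∣n⇒∣m p lc))
      ... | pd , pe , _ | qd , qe , _ =
        ∣-rearrange (lem₃ (y d) (l d)) (∣m∣n⇒∣m-n qd pd) ,
        ∣-rearrange (lem₃ (y e) (l e)) (∣m∣n⇒∣m-n qe pe)

  -- With equal kernels, the points x, x + l, x + 2l lie in three different cosets.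
  module _ {c d e : I} (C : Covering c d e)
           (c⇒d : ∀ {k} → K k → n ∣ℤ k c → n ∣ℤ k d)
           (d⇒e : ∀ {k} → K k → n ∣ℤ k d → n ∣ℤ k e)
           (e⇒c : ∀ {k} → K k → n ∣ℤ k e → n ∣ℤ k c) where
    open Covering C

    killed-3 : Killed 3 c × Killed 3 d × Killed 3 e
    killed-3 = (λ l Kl → ∣-rearrange (lem (l c)) (3lc l Kl)) ,
               (λ l Kl → ∣-rearrange (lem (l d)) (c⇒d (3K Kl) (3lc l Kl))) ,
               (λ l Kl → ∣-rearrange (lem (l e)) (d⇒e (3K Kl) (c⇒d (3K Kl) (3lc l Kl))))
      where
      3K : ∀ {l} → K l → K (l ⊕ l ⊕ l)
      3K Kl = K-⊕ (K-⊕ Kl Kl) Kl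

      lem : ∀ u → u + u + u ≡ + 3 * u
      lem = solve-∀
      lem₃ : ∀ x l → x + l + l + l - x ≡ l + l + l
      lem₃ = solve-∀
      lem₂ : ∀ x l → x + l + l - x ≡ l + l
      lem₂ = solve-∀

      module _ (l : I → ℤ) (Kl : K l) (lc : ¬ n ∣ℤ l c) where
        ld : ¬ n ∣ℤ l d
        ld p = lc (e⇒c Kl (d⇒e Kl p))

        le : ¬ n ∣ℤ l e
        le p = lc (e⇒c Kl p)

        2lc : ¬ n ∣ℤ l c + l c
        -- Equal kernels turn `2 (l c) = 0` into `2 (l d) = 0`; two nonzero involutions cancel,
        -- which leaves `l e = 0`.
        2lc p = le (∣m+n∣m⇒∣n (sum-0 Kl) (involutions-cancel p (c⇒d (K-⊕ Kl Kl) p) lc ld))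

        2ld : ¬ n ∣ℤ l d + l d
        2ld p = 2lc (e⇒c (K-⊕ Kl Kl) (d⇒e (K-⊕ Kl Kl) p))

        2le : ¬ n ∣ℤ l e + l e
        2le p = 2lc (e⇒c (K-⊕ Kl Kl) p)

        step : ∀ {u v} → n ∣ℤ u → n ∣ℤ u + v → n ∣ℤ v
        step p q = ∣m+n∣m⇒∣n q p

        step₂ : ∀ x i → n ∣ℤ x → n ∣ℤ x + l i + l i → n ∣ℤ l i + l i
        step₂ x i p q = ∣-rearrange (lem₂ x (l i)) (∣m∣n⇒∣m-n q p)

        from : ∀ {x} → X x → n ∣ℤ x c → n ∣ℤ l c + l c + l c
        -- `x + 3l` differs from `x + 2l` by `l` and from `x + l` by `2l`, so it shares neither of
        -- their zero sets and has to be a zero of `c`.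
        from {x} Xx xc with cover (X-⊕ Xx Kl) | cover (X-⊕ (X-⊕ Xx Kl) Kl) | cover (X-⊕ (X-⊕ (X-⊕ Xx Kl) Kl) Kl)
        ... | inj₁ p | _ | _ = contradiction (step xc p) lc
        ... | _ | inj₁ p | _ = contradiction (step₂ (x c) c xc p) 2lc
        ... | _ | _ | inj₁ p = ∣-rearrange (lem₃ (x c) (l c)) (∣m∣n⇒∣m-n p xc)
        ... | inj₂ (inj₁ p) | inj₂ (inj₁ q) | _ = contradiction (step p q) ld
        ... | inj₂ (inj₂ p) | inj₂ (inj₂ q) | _ = contradiction (step p q) le
        ... | _ | inj₂ (inj₁ p) | inj₂ (inj₁ q) = contradiction (step p q) ld
        ... | _ | inj₂ (inj₂ p) | inj₂ (inj₂ q) = contradiction (step p q) le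
        ... | inj₂ (inj₁ p) | _ | inj₂ (inj₁ q) = contradiction (step₂ (x d + l d) d p q) 2ld
        ... | inj₂ (inj₂ p) | _ | inj₂ (inj₂ q) = contradiction (step₂ (x e + l e) e p q) 2le

      3lc : ∀ l → K l → n ∣ℤ l c + l c + l c
      3lc l Kl with n ∣? l c
      ... | yes p = ∣m∣n⇒∣m+n (∣m∣n⇒∣m+n p p) p
      ... | no lc = at-a-zero-of-c C (from l Kl lc)

  Dichotomy : I → I → I → Set
  Dichotomy c d e = (Killed 2 c ⊎ Killed 2 d ⊎ Killed 2 e) × Killed 4 c × Killed 4 d × Killed 4 e
                     ⊎ Killed 3 c × Killed 3 d × Killed 3 e

  -- If one of the kernel inclusions `c` in `d`, `d` in `e`, `e` in `c` fails, a rotation gives the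
  -- first alternative; if all hold, they close a cycle and the kernels agree. Inclusion cannot be
  -- decided for a general `K`, whence the double negation, harmless for the goal `⊥`.
  dichotomy : ∀ {c d e} → Covering c d e → ¬ ¬ Dichotomy c d e
  dichotomy {c} {d} {e} C ¬T = ¬T (inj₂ (killed-3 C
      (λ Kk kc → decidable-stable (n ∣? _) λ kd →
        ¬T (inj₁ (inj₁ (killed-2 C Kk kc kd) , killed-4 C Kk kc kd)))
      (λ Kk kd → decidable-stable (n ∣? _) λ ke →
        let (p , q , r) = killed-4 (rotate C) Kk kd ke in
        ¬T (inj₁ (inj₂ (inj₁ (killed-2 (rotate C) Kk kd ke)) , r , p , q)))
      (λ Kk ke → decidable-stable (n ∣? _) λ kc →
        let (p , q , r) = killed-4 (rotate (rotate C)) Kk ke kc in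
        ¬T (inj₁ (inj₂ (inj₂ (killed-2 (rotate (rotate C)) Kk ke kc)) , q , r , p)))))

-- Words nonzero at two given coordinates, and what they generate.

module Columns (n : ℤ) {I : Set} (C : Pred (I → ℤ) 0ℓ)
               (C-⊕ : ∀ {v w} → C v → C w → C (v ⊕ w))
               (C-⊖ : ∀ {v w} → C v → C w → C (v ⊖ w)) where

  Good : I → I → Pred (I → ℤ) 0ℓ
  Good a b x = C x × ¬ n ∣ℤ x a × ¬ n ∣ℤ x b

  -- A group is not the union of two proper subgroups, here the kernels of `a` and `b`.
  good-exists : ∀ {a b} → (∃ λ w → C w × ¬ n ∣ℤ w a) → (∃ λ w → C w × ¬ n ∣ℤ w b) → ∃ (Good a b)
  good-exists {a} {b} (u , Cu , ua) (v , Cv , vb) with n ∣? u b | n ∣? v a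
  ... | no ub  | _      = u , Cu , ua , ub
  ... | _      | no va  = v , Cv , va , vb
  ... | yes ub | yes va = u ⊕ v , C-⊕ Cu Cv ,
        (λ p → ua (∣m+n∣n⇒∣m p va)) , (λ p → vb (∣m+n∣m⇒∣n p ub))

  module _ {a b c : I} (m : ℕ)
           (a≢0₂ : ∃ λ w → C w × ¬ n ∣ℤ w a + w a)
           (good : ∀ {x} → Good a b x → n ∣ℤ + m * x c) where

    -- If m (x c) ≢ 0, then x + y and x + 2y are not good for any good y, which forces
    -- 2 (y a) ≡ 0; but for 2 (z a) ≢ 0, either z or z + x is good.
    good-generates-a : ∃ (Good a b) → ∀ {x} → C x → n ∣ℤ x a → n ∣ℤ + m * x c
    good-generates-a (y₀ , Gy₀) {x} Cx xa = decidable-stable (n ∣? _) bad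
      where
      lem+ : ∀ m x y → m * (x + y) - m * y ≡ m * x
      lem+ = solve-∀
      lem₄ : ∀ z x → (z + x) + (z + x) - (x + x) ≡ z + z
      lem₄ = solve-∀

      bad : ¬ ¬ n ∣ℤ + m * x c
      bad mxc = 2a-off-good a≢0₂
        where
        plus-bad : ∀ {y} → Good a b y → ¬ Good a b (x ⊕ y)
        plus-bad {y} Gy G = mxc (∣-rearrange (lem+ (+ m) (x c) (y c)) (∣m∣n⇒∣m-n (good G) (good Gy)))

        plus2-bad : ∀ {y} → Good a b y → ¬ Good a b (x ⊕ y ⊕ y)
        plus2-bad {y} Gy G = mxc (∣-rearrange (lem+ (+ m) (x c) (y c)) (∣m∣n⇒∣m-n
          (∣-rearrange (lem+ (+ m) (x c + y c) (y c)) (∣m∣n⇒∣m-n (good G) (good Gy))) (good Gy)))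

        xb+yb : ∀ {y} → Good a b y → n ∣ℤ x b + y b
        xb+yb Gy@(Cy , ya , _) = decidable-stable (n ∣? _) λ q →
          plus-bad Gy (C-⊕ Cx Cy , (λ p → ya (∣m+n∣m⇒∣n p xa)) , q)

        xb : ¬ n ∣ℤ x b
        xb p = proj₂ (proj₂ Gy₀) (∣m+n∣m⇒∣n (xb+yb Gy₀) p)

        2ya : ∀ {y} → Good a b y → n ∣ℤ y a + y a
        -- As `x b + y b` vanishes, the `b` entry of `x + 2y` is congruent to `y b`, hence nonzero;
        -- only the `a` entry, `2 (y a)`, can keep it from being good.
        2ya {y} Gy@(Cy , ya , yb) = decidable-stable (n ∣? _) λ q →
          plus2-bad Gy (C-⊕ (C-⊕ Cx Cy) Cy ,
            (λ p → q (∣m+n∣m⇒∣n (∣-rearrange (ℤ.+-assoc (x a) (y a) (y a)) p) xa)) ,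
            (λ p → yb (∣m+n∣m⇒∣n p (xb+yb Gy))))

        2a-off-good : ¬ (∃ λ z → C z × ¬ n ∣ℤ z a + z a)
        2a-off-good (z , Cz , 2za) with n ∣? z b
        ... | no zb  = 2za (2ya (Cz , ∤-double (z a) 2za , zb))
        ... | yes zb = 2za (∣-rearrange (lem₄ (z a) (x a)) (∣m∣n⇒∣m-n
              (2ya (C-⊕ Cz Cx , (λ p → ∤-double (z a) 2za (∣m+n∣n⇒∣m p xa)) ,
                                (λ p → xb (∣m+n∣m⇒∣n p zb))))
              (∣m∣n⇒∣m+n xa xa)))

  -- A word that is not good vanishes at `a` or at `b`, and the two cases differ by exchanging `a`
  -- and `b`.
  good-generates : ∀ {a b c} m → (∃ λ w → C w × ¬ n ∣ℤ w a + w a) → (∃ λ w → C w × ¬ n ∣ℤ w b + w b) →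
                   (∀ {x} → Good a b x → n ∣ℤ + m * x c) → ∃ (Good a b) →
                   ∀ {x} → C x → n ∣ℤ + m * x c
  good-generates {a} {b} m 2a 2b good y {x} Cx with n ∣? x a | n ∣? x b
  ... | yes xa | _ = good-generates-a m 2a good y Cx xa
  ... | _ | yes xb = good-generates-a m 2b (λ (p , q , r) → good (p , r , q))
                       (let (y , p , q , r) = y in y , p , r , q) Cx xb
  ... | no xa | no xb = good (Cx , xa , xb)

  -- Thin codes: covering the coset of each good word.

  module Thin (α : ℕ) (C-scale : ∀ m {w} → C w → C (λ i → m * w i))
              (a b c d e : I)
              (αa : ∀ {w} → C w → n ∣ℤ + α * w a)
              (αb : ∀ {w} → C w → n ∣ℤ + α * w b)
              (αc≢0 : ∃ λ w → C w × ¬ n ∣ℤ + α * w c)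
              (αd≢0 : ∃ λ w → C w × ¬ n ∣ℤ + α * w d)
              (αe≢0 : ∃ λ w → C w × ¬ n ∣ℤ + α * w e)
              (sum-0 : ∀ {w} → C w → n ∣ℤ w a + (w b + (w c + w d + w e)))
              (thin : ∀ {w} → Good a b w → n ∣ℤ w c ⊎ n ∣ℤ w d ⊎ n ∣ℤ w e) where

    K : Pred (I → ℤ) 0ℓ
    K k = C k × n ∣ℤ k a × n ∣ℤ k b

    Coset : (I → ℤ) → Pred (I → ℤ) 0ℓ
    Coset x y = C y × n ∣ℤ y a - x a × n ∣ℤ y b - x b

    α-scale : ∀ {w} → C w → K (λ i → + α * w i)
    α-scale Cw = C-scale (+ α) Cw , αa Cw , αb Cw

    module At (x : I → ℤ) = ThreeCosets n K (Coset x)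

    -- The entries at `a` and `b` are constant modulo `n` on the coset, so all its members are good
    -- and thinness applies to them. Multiples by `α` lie in `K` and show that `c`, `d`, `e` do not
    -- vanish there.
    covering : ∀ {x} → Good a b x → At.Covering x c d e
    covering {x} (Cx , xa , xb) = record
      { K-⊕ = λ (p , q , r) (p′ , q′ , r′) → C-⊕ p p′ , ∣m∣n⇒∣m+n q q′ , ∣m∣n⇒∣m+n r r′
      ; X-⊕ = λ {y} {k} (p , q , r) (p′ , q′ , r′) → C-⊕ p p′ ,
          ∣-rearrange (lem (y a) (x a) (k a)) (∣m∣n⇒∣m+n q q′) ,
          ∣-rearrange (lem (y b) (x b) (k b)) (∣m∣n⇒∣m+n r r′)
      ; sum-0 = λ (p , q , r) → ∣m+n∣m⇒∣n (∣m+n∣m⇒∣n (sum-0 p) q) r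
      ; c≢0 = in-K αc≢0
      ; d≢0 = in-K αd≢0
      ; e≢0 = in-K αe≢0
      ; cover = λ {y} (p , q , r) → thin (p ,
          (λ s → xa (∣-rearrange (lem′ (y a) (x a)) (∣m∣n⇒∣m-n s q))) ,
          (λ s → xb (∣-rearrange (lem′ (y b) (x b)) (∣m∣n⇒∣m-n s r))))
      ; point = x , Cx , ∣-rearrange (lem″ (x a)) (∣n⇒∣m*n 0ℤ ∣-refl) ,
                         ∣-rearrange (lem″ (x b)) (∣n⇒∣m*n 0ℤ ∣-refl)
      }
      where
      lem : ∀ y x k → (y - x) + k ≡ (y + k) - x
      lem = solve-∀
      lem′ : ∀ y x → y - (y - x) ≡ x
      lem′ = solve-∀
      lem″ : ∀ x → 0ℤ * n ≡ x - x
      lem″ x = trans (ℤ.*-zeroˡ n) (sym (ℤ.+-inverseʳ x))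

      in-K : ∀ {i} → (∃ λ w → C w × ¬ n ∣ℤ + α * w i) → ∃ λ k → K k × ¬ n ∣ℤ k i
      in-K (_ , Cw , p) = _ , α-scale Cw , p

    -- Compare `x` with a zero `y` of `φ` in its coset: `y ⊖ x` lies in `K`, so `m` kills
    -- `y φ - x φ`, while `y φ` is already zero.
    killed-on-good : ∀ {x φ ψ χ} m → C x → At.Covering x φ ψ χ →
                     (∀ k → K k → n ∣ℤ + m * k φ) → n ∣ℤ + m * x φ
    killed-on-good {x} {φ} m Cx cov mφ = At.at-a-zero-of-c x cov λ {y} (Cy , ya , yb) yφ →
      ∣-rearrange (lem (+ m) (y φ) (x φ))
        (∣m∣n⇒∣m-n (∣n⇒∣m*n (+ m) yφ) (mφ (y ⊖ x) (C-⊖ Cy Cx , ya , yb)))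
      where
      lem : ∀ m y x → m * y - m * (y - x) ≡ m * x
      lem = solve-∀

    module _ (a≢0₂ : ∃ λ w → C w × ¬ n ∣ℤ w a + w a)
             (b≢0₂ : ∃ λ w → C w × ¬ n ∣ℤ w b + w b)
             (c≢0₂ : ∃ λ w → C w × ¬ n ∣ℤ + 2 * w c)
             (d≢0₂ : ∃ λ w → C w × ¬ n ∣ℤ + 2 * w d)
             (e≢0₂ : ∃ λ w → C w × ¬ n ∣ℤ + 2 * w e)
             (c≢0₃ : ∃ λ w → C w × ¬ n ∣ℤ + 3 * w c) where

      private
        weaken : ∀ {i} → (∃ λ w → C w × ¬ n ∣ℤ w i + w i) → ∃ λ w → C w × ¬ n ∣ℤ w i
        weaken {i} (w , Cw , p) = w , Cw , ∤-double (w i) p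

        base : ∃ (Good a b)
        base = good-exists (weaken a≢0₂) (weaken b≢0₂)

        escape : ∀ {φ} m → (∀ {x} → Good a b x → n ∣ℤ + m * x φ) → ¬ (∃ λ w → C w × ¬ n ∣ℤ + m * w φ)
        escape m killed (w , Cw , p) = p (good-generates m a≢0₂ b≢0₂ killed base Cw)

      not-thin : ⊥
      -- `Killed` depends on `K` and not on the coset, so the alternative found at one base word
      -- serves at every good word.
      not-thin = At.dichotomy (proj₁ base) (covering (proj₂ base)) λ where
        (inj₁ (inj₁ c2 , _)) → escape 2 (λ {x} G → killed-on-good 2 (proj₁ G) (covering G) c2) c≢0₂
        (inj₁ (inj₂ (inj₁ d2) , _)) → escape 2
          (λ {x} G → killed-on-good 2 (proj₁ G) (At.rotate x (covering G)) d2) d≢0₂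
        (inj₁ (inj₂ (inj₂ e2) , _)) → escape 2
          (λ {x} G → killed-on-good 2 (proj₁ G) (At.rotate x (At.rotate x (covering G))) e2) e≢0₂
        (inj₂ (c3 , _)) → escape 3 (λ {x} G → killed-on-good 3 (proj₁ G) (covering G) c3) c≢0₃

    Annihilated : ℕ → Set
    Annihilated m = ∀ {w} → C w →
      n ∣ℤ + m * (+ α * w c) × n ∣ℤ + m * (+ α * w d) × n ∣ℤ + m * (+ α * w e)

    -- `α` maps the code into `K`, so a multiplier that kills a coordinate on `K` becomes, times
    -- `α`, one for the whole code.
    annihilated : ∃ (Good a b) → ¬ ¬ (Annihilated 4 ⊎ Annihilated 3)
    annihilated (x , G) ¬A = At.dichotomy x (covering G) λ where
      (inj₁ (_ , c4 , d4 , e4)) → ¬A (inj₁ λ Cw → c4 _ (α-scale Cw) , d4 _ (α-scale Cw) , e4 _ (α-scale Cw))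
      (inj₂ (c3 , d3 , e3)) → ¬A (inj₂ λ Cw → c3 _ (α-scale Cw) , d3 _ (α-scale Cw) , e3 _ (α-scale Cw))

-- Passing between words over ℤ/N and integer vectors.

sumℤ : ∀ {n} → Vector ℤ n → ℤ
sumℤ = foldr _+_ 0ℤ

module _ {N : ℕ} .{{_ : NonZero N}} where

  infix 4 _≋_

  -- A record, so that `u` and `v` are determined by the type.
  record _≋_ (u v : ℤ) : Set where
    constructor congruent
    field difference : + N ∣ℤ u - v

  ≋-refl : ∀ {u} → u ≋ u
  ≋-refl {u} = congruent (divides 0ℤ (trans (ℤ.+-inverseʳ u) (sym (ℤ.*-zeroˡ (+ N)))))

  ≋-reflexive : ∀ {u v} → u ≡ v → u ≋ v
  ≋-reflexive refl = ≋-refl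

  ≋-trans : ∀ {u v w} → u ≋ v → v ≋ w → u ≋ w
  ≋-trans {u} {v} {w} (congruent p) (congruent q) = congruent (∣-rearrange (lem u v w) (∣m∣n⇒∣m+n p q))
    where
    lem : ∀ u v w → u - v + (v - w) ≡ u - w
    lem = solve-∀

  ≋-+ : ∀ {u u′ v v′} → u ≋ u′ → v ≋ v′ → u + v ≋ u′ + v′
  ≋-+ {u} {u′} {v} {v′} (congruent p) (congruent q) = congruent (∣-rearrange (lem u u′ v v′) (∣m∣n⇒∣m+n p q))
    where
    lem : ∀ u u′ v v′ → u - u′ + (v - v′) ≡ u + v - (u′ + v′)
    lem = solve-∀

  ≋-*ʳ : ∀ v {u u′} → u ≋ u′ → u * v ≋ u′ * v
  ≋-*ʳ v {u} {u′} (congruent p) = congruent (∣-rearrange (lem u u′ v) (∣m⇒∣m*n v p))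
    where
    lem : ∀ u u′ v → (u - u′) * v ≡ u * v - u′ * v
    lem = solve-∀

  ≋-*ˡ : ∀ v {u u′} → u ≋ u′ → v * u ≋ v * u′
  ≋-*ˡ v {u} {u′} p = subst₂ _≋_ (ℤ.*-comm u v) (ℤ.*-comm u′ v) (≋-*ʳ v p)

  ∣-resp-≋ : ∀ {u v} → u ≋ v → + N ∣ℤ u → + N ∣ℤ v
  ∣-resp-≋ {u} {v} (congruent p) q = ∣-rearrange (lem u v) (∣m∣n⇒∣m-n q p)
    where
    lem : ∀ u v → u - (u - v) ≡ v
    lem = solve-∀

  ≋-sym : ∀ {u v} → u ≋ v → v ≋ u
  ≋-sym {u} {v} (congruent p) = congruent (∣-rearrange (lem u v) (∣m⇒∣-m p))
    where
    lem : ∀ u v → - (u - v) ≡ v - u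
    lem = solve-∀

  toℕ-mod : ∀ k → toℕ (k mod N) ≡ k % N
  toℕ-mod k = toℕ-fromℕ< (m%n<n k N)

  mod-≋ : ∀ k → + toℕ (k mod N) ≋ + k
  mod-≋ k = congruent (divides (- + (k / N)) (remainder (toℕ-mod k) (m≡m%n+[m/n]*n k N)))
    where
    lem : ∀ r q n → r - (r + q * n) ≡ - q * n
    lem = solve-∀
    remainder : ∀ {t} → t ≡ k % N → k ≡ k % N ℕ.+ k / N ℕ.* N → + t - + k ≡ - + (k / N) * + N
    remainder refl eq = trans
      (cong (λ v → + (k % N) - v) (trans (cong +_ eq) (trans (ℤ.pos-+ (k % N) _)
        (cong (λ v → + (k % N) + v) (ℤ.pos-* (k / N) N)))))
      (lem (+ (k % N)) (+ (k / N)) (+ N))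

  +-≋ : ∀ (x y : ℤ/ N) → + toℕ (x ℤ/N.+ y) ≋ + toℕ x + + toℕ y
  +-≋ x y = ≋-trans (mod-≋ (toℕ x ℕ.+ toℕ y)) (≋-reflexive (ℤ.pos-+ (toℕ x) (toℕ y)))

  *-≋ : ∀ (x y : ℤ/ N) → + toℕ (x ℤ/N.* y) ≋ + toℕ x * + toℕ y
  *-≋ x y = ≋-trans (mod-≋ (toℕ x ℕ.* toℕ y)) (≋-reflexive (ℤ.pos-* (toℕ x) (toℕ y)))

  ∑-≋ : ∀ {n} (w : Word N n) (v : Vector ℤ n) → (∀ i → + toℕ (w i) ≋ v i) → + toℕ (∑ w) ≋ sumℤ v
  ∑-≋ {ℕ.zero}  w v w≋v = mod-≋ 0
  ∑-≋ {ℕ.suc n} w v w≋v = ≋-trans (+-≋ (w zero) (∑ (w ∘ suc)))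
    (≋-+ (w≋v zero) (∑-≋ (w ∘ suc) (v ∘ suc) (w≋v ∘ suc)))

  residue : ℤ → ℤ/ N
  residue x = (x %ℕ N) mod N

  residue-≋ : ∀ x → + toℕ (residue x) ≋ x
  residue-≋ x = ≋-trans (mod-≋ (x %ℕ N))
    (congruent (divides (- (x /ℕ N)) (trans (cong (λ v → + (x %ℕ N) - v) (a≡a%ℕn+[a/ℕn]*n x N))
      (lem (+ (x %ℕ N)) (x /ℕ N) (+ N)))))
    where
    lem : ∀ r q n → r - (r + q * n) ≡ - q * n
    lem = solve-∀

  ≡0⇒∣ : ∀ {x : ℤ/ N} → x ≡ 0# → + N ∣ℤ + toℕ x
  ≡0⇒∣ refl = ∣-resp-≋ (≋-sym (mod-≋ 0)) (divides 0ℤ refl)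

  module _ {n} (g : Matrix N 2 n) where

    combination : ℤ → ℤ → Fin n → ℤ
    combination x y i = x * + toℕ (g zero i) + y * + toℕ (g (suc zero) i)

    -- An integer lift of the code. Coefficients range over all of ℤ, so closure under sums,
    -- differences and multiples holds exactly and not just modulo `N`.
    Span : Pred (Fin n → ℤ) 0ℓ
    Span w = ∃₂ λ x y → ∀ i → w i ≡ combination x y i

    Span-⊕ : ∀ {v w} → Span v → Span w → Span (v ⊕ w)
    Span-⊕ (x , y , p) (x′ , y′ , q) = x + x′ , y + y′ , λ i →
      trans (cong₂ _+_ (p i) (q i)) (lem x y x′ y′ _ _)
      where
      lem : ∀ x y x′ y′ s t → (x * s + y * t) + (x′ * s + y′ * t) ≡ (x + x′) * s + (y + y′) * t
      lem = solve-∀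

    Span-⊖ : ∀ {v w} → Span v → Span w → Span (v ⊖ w)
    Span-⊖ (x , y , p) (x′ , y′ , q) = x - x′ , y - y′ , λ i →
      trans (cong₂ _-_ (p i) (q i)) (lem x y x′ y′ _ _)
      where
      lem : ∀ x y x′ y′ s t → (x * s + y * t) - (x′ * s + y′ * t) ≡ (x - x′) * s + (y - y′) * t
      lem = solve-∀

    Span-scale : ∀ m {w} → Span w → Span (λ i → m * w i)
    Span-scale m (x , y , p) = m * x , m * y , λ i → trans (cong (m *_) (p i)) (lem m x y _ _)
      where
      lem : ∀ m x y s t → m * (x * s + y * t) ≡ m * x * s + m * y * t
      lem = solve-∀

    Span-row : ∀ r → Span (λ i → + toℕ (g r i))
    Span-row zero       = 1ℤ , 0ℤ , λ i → lem (+ toℕ (g zero i)) (+ toℕ (g (suc zero) i))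
      where
      lem : ∀ s t → s ≡ 1ℤ * s + 0ℤ * t
      lem = solve-∀
    Span-row (suc zero) = 0ℤ , 1ℤ , λ i → lem (+ toℕ (g zero i)) (+ toℕ (g (suc zero) i))
      where
      lem : ∀ s t → t ≡ 0ℤ * s + 1ℤ * t
      lem = solve-∀

    private
      lem-sum : ∀ x y s t → x * s + (y * t + 0ℤ) ≡ x * s + y * t
      lem-sum = solve-∀

    word-≋ : ∀ (c : Vector (ℤ/ N) 2) x y → + toℕ (c zero) ≋ x → + toℕ (c (suc zero)) ≋ y →
             ∀ i → + toℕ (∑ (λ r → c r ℤ/N.* g r i)) ≋ combination x y i
    word-≋ c x y p q i = ≋-trans
      (∑-≋ (λ r → c r ℤ/N.* g r i) (λ r → z r * + toℕ (g r i)) λ where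
        zero       → ≋-trans (*-≋ (c zero) (g zero i)) (≋-*ʳ _ p)
        (suc zero) → ≋-trans (*-≋ (c (suc zero)) (g (suc zero) i)) (≋-*ʳ _ q))
      (≋-reflexive (lem-sum x y (+ toℕ (g zero i)) (+ toℕ (g (suc zero) i))))
      where
      z : Vector ℤ 2
      z zero = x
      z (suc zero) = y

    Span⇒code : ∀ {w} → Span w → ∃ λ v → ⟨ g ⟩ v × (∀ i → + toℕ (v i) ≋ w i)
    Span⇒code {w} (x , y , p) = _ , (c , λ _ → refl) ,
      λ i → ≋-trans (word-≋ c x y (residue-≋ x) (residue-≋ y) i) (≋-reflexive (sym (p i)))
      where
      c : Vector (ℤ/ N) 2
      c zero       = residue x
      c (suc zero) = residue y

    code⇒Span : ∀ {v} → ⟨ g ⟩ v → ∃ λ w → Span w × (∀ i → + toℕ (v i) ≋ w i)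
    code⇒Span (c , p) = _ , (+ toℕ (c zero) , + toℕ (c (suc zero)) , λ _ → refl) , λ i →
      subst (λ u → + toℕ u ≋ _) (sym (p i))
        (word-≋ c _ _ ≋-refl ≋-refl i)

    extended⇒sum-0 : Extended ⟨ g ⟩ → ∀ {w} → Span w → + N ∣ℤ sumℤ w
    extended⇒sum-0 ext {w} Sw = let (v , gv , v≋w) = Span⇒code Sw in
      ∣-resp-≋ (∑-≋ v w v≋w) (≡0⇒∣ (ext v gv))

    thin⇒zero-entry : Thin ⟨ g ⟩ → ∀ {w} → Span w → ¬ (∀ i → ¬ + N ∣ℤ w i)
    thin⇒zero-entry thin {w} Sw w≢0 = let (v , gv , v≋w) = Span⇒code Sw in thin (v , gv , λ i vi≡0 → w≢0 i (∣-resp-≋ (v≋w i) (≡0⇒∣ vi≡0)))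

-- Column gcds and the multipliers that annihilate a column.

foldr-gcd-∣ : ∀ {m} N (v : Vector ℕ m) r → foldr gcd N v ∣ v r
foldr-gcd-∣ N v zero    = gcd[m,n]∣m (v zero) _
foldr-gcd-∣ N v (suc r) = ℕ∣.∣-trans (gcd[m,n]∣n (v zero) _) (foldr-gcd-∣ N (v ∘ suc) r)

foldr-gcd-∣N : ∀ {m} N (v : Vector ℕ m) → foldr gcd N v ∣ N
foldr-gcd-∣N {ℕ.zero}  N v = ℕ∣.∣-refl
foldr-gcd-∣N {ℕ.suc m} N v = ℕ∣.∣-trans (gcd[m,n]∣n (v zero) _) (foldr-gcd-∣N N (v ∘ suc))

-- Multiplication distributes over gcd; the seed `N` of the fold contributes `k * N`.
∣-*-foldr-gcd : ∀ {m} N k (v : Vector ℕ m) → (∀ r → N ∣ k ℕ.* v r) → N ∣ k ℕ.* foldr gcd N v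
∣-*-foldr-gcd {ℕ.zero}  N k v p = ℕ∣.n∣m*n k
∣-*-foldr-gcd {ℕ.suc m} N k v p = subst (N ∣_) (sym (c*gcd[m,n]≡gcd[cm,cn] k (v zero) _))
  (gcd-greatest (p zero) (∣-*-foldr-gcd N k (v ∘ suc) (p ∘ suc)))

module _ {N : ℕ} .{{_ : NonZero N}} {n} (g : Matrix N 2 n) where

  column-killed : ∀ m i → N ∣ m ℕ.* columnGcd g i → ∀ {w} → Span g w → + N ∣ℤ + m * w i
  column-killed m i p {w} (x , y , eq) = subst (λ u → + N ∣ℤ + m * u) (sym (eq i))
    (∣-rearrange (lem (+ m) x y _ _) (∣m∣n⇒∣m+n (∣n⇒∣m*n x (entry zero)) (∣n⇒∣m*n y (entry (suc zero)))))
    where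
    lem : ∀ m x y s t → x * (m * s) + y * (m * t) ≡ m * (x * s + y * t)
    lem = solve-∀
    entry : ∀ r → + N ∣ℤ + m * + toℕ (g r i)
    entry r = subst (+ N ∣ℤ_) (ℤ.pos-* m _)
      (∣ᵤ⇒∣ (ℕ∣.∣-trans p (ℕ∣.*-monoʳ-∣ m (foldr-gcd-∣ N (λ r → toℕ (g r i)) r))))

  -- Were `m` times both entries of the column divisible by `N`, so would be `m` times their gcd
  -- with `N`; hence a row of `g` is itself a witness.
  column-not-killed : ∀ m i → ¬ N ∣ m ℕ.* columnGcd g i → ∃ λ w → Span g w × ¬ + N ∣ℤ + m * w i
  column-not-killed m i p with ¬∀⟶∃¬ 2 (λ r → N ∣ m ℕ.* toℕ (g r i)) (λ r → N ℕ∣.∣? _)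
                                  (p ∘ ∣-*-foldr-gcd N m (λ r → toℕ (g r i)))
  ... | r , q = _ , Span-row g r , λ s → q (∣⇒∣ᵤ (subst (+ N ∣ℤ_) (sym (ℤ.pos-* m _)) s))

  columnGcd-positive : ∀ i → 0 < columnGcd g i
  columnGcd-positive i = ℕ.n≢0⇒n>0 λ eq → ℕ.≢-nonZero⁻¹ N
    (ℕ∣.0∣⇒≡0 (subst (_∣ N) eq (foldr-gcd-∣N N (λ r → toℕ (g r i)))))

-- Separating two coordinates from the rest.

module _ {n} {i j : Fin (2 ℕ.+ n)} (i≢j : i ≢ j) where

  -- `punchOut i≢j` is the place of `j` once `i` is removed; skipping both places enumerates the
  -- remaining indices.
  others : Fin n → Fin (2 ℕ.+ n)
  others k = punchIn i (punchIn (punchOut i≢j) k)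

  others≢i : ∀ k → others k ≢ i
  others≢i k = punchInᵢ≢i i _

  others≢j : ∀ k → others k ≢ j
  others≢j k eq = punchInᵢ≢i (punchOut i≢j) k
    (punchIn-injective i _ _ (trans eq (sym (punchIn-punchOut i≢j))))

  others-elim : (P : Pred (Fin (2 ℕ.+ n)) 0ℓ) → P i → P j → (∀ k → P (others k)) → ∀ k → P k
  others-elim P Pi Pj Pk k with i ≟ k
  ... | yes refl = Pi
  ... | no i≢k with punchOut i≢j ≟ punchOut i≢k
  ... | yes eq = subst P (trans (sym (punchIn-punchOut i≢j)) (trans (cong (punchIn i) eq) (punchIn-punchOut i≢k))) Pj
  ... | no j≢k = subst P (trans (cong (punchIn i) (punchIn-punchOut j≢k)) (punchIn-punchOut i≢k))
                   (Pk (punchOut j≢k))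

  sum-others : ∀ (w : Fin (2 ℕ.+ n) → ℤ) → sumℤ w ≡ w i + (w j + sumℤ (w ∘ others))
  sum-others w = trans (sum-remove {i = i} w) (cong (λ u → w i + u)
    (trans (sum-remove {i = punchOut i≢j} (w ∘ punchIn i)) (cong (λ k → w k + sumℤ (w ∘ others)) (punchIn-punchOut i≢j))))

-- N / gcd N m divides every entry, so it is 1.
gcd-1⇒∣ : ∀ {N} .{{_ : NonZero N}} (S : Pred ℕ 0ℓ) m → IsGCD S 1 → S N → (∀ k → S k → N ∣ m ℕ.* k) → N ∣ m
gcd-1⇒∣ {N} S m (_ , greatest) SN p = subst (_∣ m) N≡D (gcd[m,n]∣n N m)
  where
  D : ℕ
  D = gcd N m
  instance
    D≢0 : NonZero D
    D≢0 = ℕ.≢-nonZero (gcd[m,n]≢0 N m (inj₁ (ℕ.≢-nonZero⁻¹ N)))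
  N/D*D : N / D ℕ.* D ≡ N
  N/D*D = m/n*n≡m (gcd[m,n]∣m N m)
  m/D*D : m / D ℕ.* D ≡ m
  m/D*D = m/n*n≡m (gcd[m,n]∣n N m)
  divides-all : ∀ k → S k → N / D ∣ k
  -- Cancelling `D` from `N ∣ m * k` leaves `N / D` dividing `(m / D) * k`, and `N / D` is coprime
  -- to `m / D`.
  divides-all k Sk = coprime-divisor (coprime-/gcd N m) (ℕ∣.*-cancelʳ-∣ D
    (subst₂ _∣_ (sym N/D*D) (trans (cong (ℕ._* k) (sym m/D*D)) (lem (m / D) D k)) (p k Sk)))
    where
    lem : ∀ a b c → a ℕ.* b ℕ.* c ≡ a ℕ.* c ℕ.* b
    lem a b c = trans (ℕ.*-assoc a b c) (trans (cong (a ℕ.*_) (ℕ.*-comm b c)) (sym (ℕ.*-assoc a c b)))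
  N≡D : D ≡ N
  N≡D = trans (sym (ℕ.*-identityˡ D)) (trans (cong (ℕ._* D) (sym (ℕ∣.∣1⇒≡1 (greatest (N / D) divides-all)))) N/D*D)

-- From the column gcds to the contradictions.

module _ {N : ℕ} .{{_ : NonZero N}} (g : Matrix N 2 5) (α M : ℕ) (α*M≡N : α ℕ.* M ≡ N) (2≤α : 2 ≤ α)
         (adm : Admissible ⟨ g ⟩) (thin : Thin ⟨ g ⟩)
         {a b : Fin 5} (a≢b : a ≢ b) (γa : columnGcd g a ≡ M) (γb : columnGcd g b ≡ M)
         (γ< : ∀ k → columnGcd g (others a≢b k) < M) where

  private
    col : Fin 3 → Fin 5
    col = others a≢b

    α-kills : ∀ {i} → columnGcd g i ≡ M → ∀ {w} → Span g w → + N ∣ℤ + α * w i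
    α-kills {i} γ = column-killed g α i (ℕ∣.∣-reflexive (trans (sym α*M≡N) (cong (α ℕ.*_) (sym γ))))

    strictly-between : ∀ m i → 0 < m → m ℕ.* columnGcd g i < N → ∃ λ w → Span g w × ¬ + N ∣ℤ + m * w i
    strictly-between m i 0<m mγ<N = column-not-killed g m i λ p → ℕ.<⇒≱ mγ<N
      (ℕ∣.∣⇒≤ {{ℕ.>-nonZero (ℕ.*-mono-< 0<m (columnGcd-positive g i))}} p)

    M-not-killed : ∀ m {i} → columnGcd g i ≡ M → 0 < m → m < α → ∃ λ w → Span g w × ¬ + N ∣ℤ + m * w i
    M-not-killed m {i} refl 0<m m<α = strictly-between m i 0<m
      (subst (m ℕ.* M <_) α*M≡N (ℕ.*-monoˡ-< M {{ℕ.>-nonZero (columnGcd-positive g i)}} m<α))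

    -- The strict bound on these gcds admits `m = α`, the case that makes these columns nonzero on
    -- `K`.
    other-not-killed : ∀ m k → 0 < m → m ≤ α → ∃ λ w → Span g w × ¬ + N ∣ℤ + m * w (col k)
    other-not-killed m k 0<m m≤α = strictly-between m (col k) 0<m (ℕ.<-≤-trans
      (ℕ.*-monoʳ-< m {{ℕ.>-nonZero 0<m}} (γ< k)) (subst (m ℕ.* M ≤_) α*M≡N (ℕ.*-monoˡ-≤ M m≤α)))

    0<α : 0 < α
    0<α = ℕ.<-≤-trans z<s 2≤α

    lem-sum : ∀ x y z → x + (y + (z + 0ℤ)) ≡ x + y + z
    lem-sum = solve-∀

    open Columns (+ N) (Span g) (Span-⊕ g) (Span-⊖ g)

    thin-others : ∀ {w} → Good a b w →
                  + N ∣ℤ w (col zero) ⊎ + N ∣ℤ w (col (suc zero)) ⊎ + N ∣ℤ w (col (suc (suc zero)))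
    thin-others {w} (Sw , wa , wb) with + N ∣? w (col zero) | + N ∣? w (col (suc zero)) | + N ∣? w (col (suc (suc zero)))
    ... | yes p | _ | _ = inj₁ p
    ... | _ | yes p | _ = inj₂ (inj₁ p)
    ... | _ | _ | yes p = inj₂ (inj₂ p)
    ... | no p | no q | no r = contradiction
          (others-elim a≢b (λ i → ¬ + N ∣ℤ w i) wa wb λ { zero → p ; (suc zero) → q ; (suc (suc zero)) → r })
          (thin⇒zero-entry g thin Sw)

    open Thin α (Span-scale g) a b (col zero) (col (suc zero)) (col (suc (suc zero)))
      (α-kills γa) (α-kills γb)
      (other-not-killed α zero 0<α ℕ.≤-refl) (other-not-killed α (suc zero) 0<α ℕ.≤-refl)
      (other-not-killed α (suc (suc zero)) 0<α ℕ.≤-refl)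
      (λ {w} Sw → ∣-rearrange (trans (sum-others a≢b w)
         (cong (λ u → w a + (w b + u)) (lem-sum (w (col zero)) _ _))) (extended⇒sum-0 g (proj₁ adm) Sw))
      thin-others

  -- Columns `a` and `b` survive doubling because `2 < α`; the other columns survive 2 and 3 because
  -- both are at most `α`.
  not-thin-3≤α : 3 ≤ α → ⊥
  not-thin-3≤α 3≤α = not-thin (twice γa) (twice γb)
    (other-not-killed 2 zero z<s 2≤α) (other-not-killed 2 (suc zero) z<s 2≤α)
    (other-not-killed 2 (suc (suc zero)) z<s 2≤α) (other-not-killed 3 zero z<s 3≤α)
    where
    twice : ∀ {i} → columnGcd g i ≡ M → ∃ λ w → Span g w × ¬ + N ∣ℤ w i + w i
    twice {i} γ with M-not-killed 2 γ z<s 3≤α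
    ... | w , Sw , p = w , Sw , λ q → p (∣-double (w i) q)

  -- A good word exists because `1 < α`. Then `4 α` or `3 α` annihilates every entry of the code,
  -- and admissibility makes it a multiple of `N`.
  N-small : ¬ ¬ (N ∣ 4 ℕ.* α ⊎ N ∣ 3 ℕ.* α)
  N-small ¬small = annihilated (good-exists (once γa) (once γb)) λ where
      (inj₁ A) → ¬small (inj₁ (divides-modulus 4 A))
      (inj₂ A) → ¬small (inj₂ (divides-modulus 3 A))
    where
    once : ∀ {i} → columnGcd g i ≡ M → ∃ λ w → Span g w × ¬ + N ∣ℤ w i
    once {i} γ with M-not-killed 1 γ z<s 2≤α
    ... | w , Sw , p = w , Sw , λ q → p (∣n⇒∣m*n (+ 1) q)

    divides-modulus : ∀ m → Annihilated m → N ∣ m ℕ.* α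
    divides-modulus m A = gcd-1⇒∣ (ModulusOrEntry ⟨ g ⟩) (m ℕ.* α) (proj₂ adm) (inj₁ refl) λ where
        _ (inj₁ refl) → ℕ∣.n∣m*n (m ℕ.* α)
        _ (inj₂ (v , i , gv , refl)) → entry i (code⇒Span g gv)
      where
      kills : ∀ i {w} → Span g w → + N ∣ℤ + m * (+ α * w i)
      kills i {w} Sw with A Sw
      ... | p , q , r = others-elim a≢b (λ i → + N ∣ℤ + m * (+ α * w i))
        (∣n⇒∣m*n (+ m) (α-kills γa Sw)) (∣n⇒∣m*n (+ m) (α-kills γb Sw))
        (λ { zero → p ; (suc zero) → q ; (suc (suc zero)) → r }) i

      entry : ∀ {v : Word N 5} i → (∃ λ w → Span g w × (∀ i → + toℕ (v i) ≋ w i)) → N ∣ m ℕ.* α ℕ.* toℕ (v i)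
      entry {v} i (w , Sw , v≋w) = ∣⇒∣ᵤ (∣-rearrange lem-pos
        (∣-resp-≋ (≋-sym (≋-*ˡ (+ m * + α) (v≋w i)))
          (∣-rearrange (sym (ℤ.*-assoc (+ m) (+ α) (w i))) (kills i Sw))))
        where
        lem-pos : + m * + α * + toℕ (v i) ≡ + (m ℕ.* α ℕ.* toℕ (v i))
        lem-pos = sym (trans (ℤ.pos-* (m ℕ.* α) _) (cong (_* + toℕ (v i)) (ℤ.pos-* m α)))

lemma3p7 : (N α : ℕ) .{{_ : NonZero N}} .{{_ : NonZero α}} →
    9 ≤ N →
    α ≡ 2 ⊎ α ≡ 3 ⊎ α ≡ 4 →
    α ∣ N →
    (g : Matrix N 2 5) →
    Admissible ⟨ g ⟩ →
    ExactlyTwo (λ i → columnGcd g i ≡ N / α) →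
    (∀ i → columnGcd g i ≢ N / α → columnGcd g i < N / α) →
    ¬ (Thin ⟨ g ⟩ × ¬ Degenerate ⟨ g ⟩)
lemma3p7 N α 9≤N α∈ α∣N g adm (a , b , a≢b , γa , γb , only) γ< (thin , _) = by-cases α∈
  where
  α*M≡N : α ℕ.* (N / α) ≡ N
  α*M≡N = m*[n/m]≡n α∣N

  γ<-others : ∀ k → columnGcd g (others a≢b k) < N / α
  γ<-others k = γ< _ λ eq → [ others≢i a≢b k , others≢j a≢b k ]′ (only _ eq)

  too-large : ∀ m → m < 9 → .{{NonZero m}} → ¬ N ∣ m
  too-large m m<9 N∣m = ℕ.<⇒≱ m<9 (ℕ.≤-trans 9≤N (ℕ∣.∣⇒≤ N∣m))

  large : 3 ≤ α → ⊥
  large 3≤α = not-thin-3≤α g α (N / α) α*M≡N (ℕ.≤-trans (s≤s (s≤s z≤n)) 3≤α) adm thin a≢b γa γb γ<-others 3≤α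

  by-cases : α ≡ 2 ⊎ α ≡ 3 ⊎ α ≡ 4 → ⊥
  -- For `α = 2` doubling kills columns `a` and `b`, so the size of `N` is used instead: it would
  -- divide 8 or 6.
  by-cases (inj₁ refl) = N-small g α (N / α) α*M≡N ℕ.≤-refl adm thin a≢b γa γb γ<-others
    [ too-large 8 (ℕ.≤-refl) , too-large 6 (ℕ.m≤n⇒m≤o+n 2 ℕ.≤-refl) ]′
  by-cases (inj₂ (inj₁ refl)) = large ℕ.≤-refl
  by-cases (inj₂ (inj₂ refl)) = large (ℕ.n≤1+n 3)
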